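{- For every offline budget $s\ge1$ and every online budget $t$ ($s,t\in\mathbb N\cup\{\infty\}$), the Lowest-Cost-Path algorithm (LCP) run in $\mathrm{OMP}_3(s,t)$, with any fixed deterministic tie-breaking rule, never reassigns an offline vertex more than once. Consequently, LCP is an SP-Greedy algorithm for $\mathrm{OMP}_3(s,t)$.
   Context: Online bipartite matching: an instance $(G,\pi)$ is a finite bipartite graph $G=(L,R,E)$ and an arrival order $\pi$ of $R$. The offline side $L$ is known in advance; online vertices $j\in R$ arrive one by one in order $\pi$, and upon arrival of $j$ all edges incident to $j$ are revealed. The algorithm maintains a matching $M$, initially empty. A vertex is free if it is currently unmatched. $\mathrm{OMP}_3(s,t)$: upon arrival of $j$, the algorithm either leaves $j$ unmatched (forever, unless matched at this moment) or augments the current matching along an augmenting path of length $1$ or $3$ that starts at $j$ and ends at a free vertex of $L$. A length-1 path $[j~i]$ adds $ji$ with $i\in L$ free. A length-3 path $[j~x~y~i]$, with $x,i\in L$, $y\in R$, $xy\in M$, $i$ free, $jx,yi\in E$, replaces $M$ by $(M\setminus\{xy\})\cup\{jx,yi\}$; then $x$ and $y$ are each said to be reassigned once. Over the execution, each vertex of $L$ may be reassigned at most $s$ times and each vertex of $R$ at most $t$ times. A vertex is exhausted once it has reached its budget; an augmentation is feasible if every vertex it would reassign is not exhausted before it. LCP: upon arrival of $j$, initialize a counter $c_j=0$. If $j$ has a free neighbor $i\in L$, match $j$ to such an $i$. Otherwise, among all augmenting $3$-paths $[j~x~y~i]$ that are feasible, choose one minimizing $c_y$ (the number of times $y$ has been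 reassigned so far), augment along it and increase $c_y$ by 1; if there is none, leave $j$ unmatched. Ties are broken by an arbitrary fixed deterministic rule. (LCP only tracks the online counters $c_y$, i.e. it does not itself keep offline reassignment counters.) An algorithm is SP-Greedy for $\mathrm{OMP}_3(s,t)$ if, upon each arrival $j$, it augments along some feasible path of length 1 or 3 starting at $j$ whenever such a path exists, and otherwise leaves $j$ unmatched. -}

module Defs where

open import Data.Nat.Base using (ℕ; suc; _≤_)
import Data.Nat.Properties as ℕ
open import Data.Fin.Base using (Fin; toℕ)
import Data.Fin.Properties as Fin
open import Data.Fin.Permutation using (Permutation′; _⟨$⟩ʳ_)
open import Data.Fin.Subset using (Subset) renaming (⊥ to ∅; _∈_ to _∈ₛ_)
open import Data.Fin.Subset.Properties using () renaming (_∈?_ to _∈ₛ?_)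
open import Data.List.Base using (List; []; _∷_; map; filter; tabulate; take; reverse; allFin; cartesianProduct)
open import Data.List.Membership.Propositional using (_∈_)
import Data.List.Membership.DecPropositional as DecMembership
open import Data.List.Relation.Unary.All using (all?)
open import Data.Maybe.Base using (Maybe; just; nothing)
open import Data.Product.Base using (_×_; _,_; proj₁; ∃-syntax)
import Data.Product.Properties as Product
open import Data.Unit.Base using (⊤; tt)
open import Data.Vec.Functional using (updateAt)
open import Function.Base using (_∘_; const)
open import Relation.Binary.PropositionalEquality.Core using (_≡_)
import Relation.Binary.Construct.Add.Supremum.NonStrict as Supremum
open import Relation.Nullary.Construct.Add.Supremum using (_⁺; ⊤⁺; [_])
open import Relation.Nullary.Decidable using (Dec; yes; no; ¬?; _×-dec_)
open import Relation.Nullary.Negation.Core using (¬_)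
open import Relation.Unary using (Decidable)

-- ℕ ∪ {∞}, with ∞ written ⊤⁺.
Budget : Set
Budget = ℕ ⁺

open Supremum _≤_ public using (_≤⁺_; ≤⁺-dec)

Exhausted : Budget → ℕ → Set
Exhausted b c = b ≤⁺ [ c ]

-- n offline vertices L = Fin n, m online vertices R = Fin m.
module _ {n m : ℕ} where

  -- A bipartite graph, given by the neighbourhood in L of each vertex of R.
  Graph : Set
  Graph = Fin m → Subset n

  Edge : Set
  Edge = Fin n × Fin m

  _≟ᴱ_ : (e f : Edge) → Dec (e ≡ f)
  _≟ᴱ_ = Product.≡-dec Fin._≟_ Fin._≟_

  open DecMembership _≟ᴱ_ using (_∈?_)

  record State : Set where
    constructor state
    field
      matching    : List Edge
      reassignedL : Fin n → ℕ
      reassignedR : Fin m → ℕ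

  open State public

  initial : State
  initial = state [] (const 0) (const 0)

  Free : State → Fin n → Set
  Free σ i = ¬ (∃[ y ] (i , y) ∈ matching σ)

  free? : ∀ σ → Decidable (Free σ)
  free? σ i = ¬? (Fin.any? λ y → (i , y) ∈? matching σ)

  -- The arriving vertex j at which a path starts is kept implicit:
  -- path₁ i is [j i] and path₃ x y i is [j x y i].
  data Path : Set where
    path₁ : (i : Fin n) → Path
    path₃ : (x : Fin n) (y : Fin m) (i : Fin n) → Path

  Augmenting : Graph → State → Fin m → Path → Set
  Augmenting G σ j (path₁ i)     = i ∈ₛ G j × Free σ i
  Augmenting G σ j (path₃ x y i) = x ∈ₛ G j × (x , y) ∈ matching σ × i ∈ₛ G y × Free σ i

  WithinBudget : (s t : Budget) → State → Path → Set
  WithinBudget s t σ (path₁ i)     = ⊤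
  WithinBudget s t σ (path₃ x y i) = ¬ Exhausted s (reassignedL σ x) × ¬ Exhausted t (reassignedR σ y)

  Feasible : (s t : Budget) → Graph → State → Fin m → Path → Set
  Feasible s t G σ j p = Augmenting G σ j p × WithinBudget s t σ p

  augmenting? : ∀ G σ j → Decidable (Augmenting G σ j)
  augmenting? G σ j (path₁ i)     = (i ∈ₛ? G j) ×-dec free? σ i
  augmenting? G σ j (path₃ x y i) =
    (x ∈ₛ? G j) ×-dec ((x , y) ∈? matching σ) ×-dec (i ∈ₛ? G y) ×-dec free? σ i

  withinBudget? : ∀ s t σ → Decidable (WithinBudget s t σ)
  withinBudget? s t σ (path₁ i)     = yes tt
  withinBudget? s t σ (path₃ x y i) =
    ¬? (≤⁺-dec ℕ._≤?_ s [ reassignedL σ x ]) ×-dec ¬? (≤⁺-dec ℕ._≤?_ t [ reassignedR σ y ])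

  feasible? : ∀ s t G σ j → Decidable (Feasible s t G σ j)
  feasible? s t G σ j p = augmenting? G σ j p ×-dec withinBudget? s t σ p

  augment : Fin m → Path → State → State
  augment j (path₁ i)     σ = record σ { matching = (i , j) ∷ matching σ }
  augment j (path₃ x y i) σ = record
    { matching    = (x , j) ∷ (i , y) ∷ filter (λ e → ¬? (e ≟ᴱ (x , y))) (matching σ)
    ; reassignedL = updateAt (reassignedL σ) x suc
    ; reassignedR = updateAt (reassignedR σ) y suc
    }

  -- An arriving online vertex together with its revealed neighbourhood.
  Arrival : Set
  Arrival = Fin m × Subset n

  -- Most recent arrival first.
  History : Set
  History = List Arrival

  revealed : History → Graph
  revealed []            y = ∅
  revealed ((j , N) ∷ H) y with y Fin.≟ j
  ... | yes _ = N
  ... | no  _ = revealed H y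

  -- Given the past, the current arrival and the current state, an online
  -- algorithm either picks a path to augment along or leaves the arriving
  -- vertex unmatched. Legality of the choice is not built in.
  Algorithm : Set
  Algorithm = History → Arrival → State → Maybe Path

  step : Fin m → Maybe Path → State → State
  step j nothing  σ = σ
  step j (just p) σ = augment j p σ

  execute : Algorithm → History → State
  execute A []      = initial
  execute A (a ∷ H) = step (proj₁ a) (A H a (execute A H)) (execute A H)

  -- A deterministic choice from a nonempty list of tied paths; it may depend
  -- on everything revealed so far, the current arrival included.
  TieBreak : Set
  TieBreak = History → (p : Path) (ps : List Path) → ∃[ q ] q ∈ p ∷ ps

  paths₁ : List Path
  paths₁ = map path₁ (allFin n)

  paths₃ : List Path
  paths₃ = map (λ (x , y , i) → path₃ x y i)
               (cartesianProduct (allFin n) (cartesianProduct (allFin m) (allFin n)))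

  -- Only used to compare 3-paths.
  cost : State → Path → ℕ
  cost σ (path₁ i)     = 0
  cost σ (path₃ x y i) = reassignedR σ y

  cheapest : State → List Path → List Path
  cheapest σ ps = filter (λ p → all? (λ q → cost σ p ℕ.≤? cost σ q) ps) ps

  choose : TieBreak → History → List Path → Maybe Path
  choose τ H []       = nothing
  choose τ H (p ∷ ps) = just (proj₁ (τ H p ps))

  -- LCP keeps no offline counters, so the 3-paths it considers are those that
  -- are feasible for the online budget t alone (offline budget ∞); respecting
  -- the offline budget is not enforced by the algorithm.
  lcp : Budget → TieBreak → Algorithm
  lcp t τ H (j , N) σ with filter (augmenting? (revealed ((j , N) ∷ H)) σ j) paths₁
  ... | p ∷ ps = choose τ ((j , N) ∷ H) (p ∷ ps)
  ... | []     = choose τ ((j , N) ∷ H)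
                   (cheapest σ (filter (feasible? ⊤⁺ t (revealed ((j , N) ∷ H)) σ j) paths₃))

record Instance (n m : ℕ) : Set where
  field
    graph : Graph {n} {m}
    order : Permutation′ m  -- order ⟨$⟩ʳ k is the k-th vertex to arrive

  arrival : Fin m → Arrival {n} {m}
  arrival k = order ⟨$⟩ʳ k , graph (order ⟨$⟩ʳ k)

  before : Fin m → History {n} {m}
  before k = reverse (take (toℕ k) (tabulate arrival))

  complete : History {n} {m}
  complete = reverse (tabulate arrival)

open Instance public

SPGreedy : ∀ {n m} → (s t : Budget) → Algorithm {n} {m} → Set
SPGreedy {n} {m} s t A = ∀ (I : Instance n m) (k : Fin m) →
  let σ        = execute A (before I k)
      decision = A (before I k) (arrival I k) σ
      feasible = Feasible s t (graph I) σ (order I ⟨$⟩ʳ k)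
  in ((∃[ p ] feasible p) → ∃[ p ] decision ≡ just p × feasible p)
   × (¬ (∃[ p ] feasible p) → decision ≡ nothing)

{-# OPTIONS --safe #-}

-- When x is reassigned along [j x y i], its new partner j has no free neighbour,
-- and it never gets one, since matched offline vertices stay matched. Hence no
-- later path [j' x j i'] exists, so x is never reassigned again and the offline
-- budget s ≥ 1 never restricts LCP.
module Submission where

open import Defs
open import Data.Empty using (⊥-elim)
open import Data.Nat.Base using (ℕ; suc; _≤_; z≤n)
open import Data.Nat.Properties using (_≤?_; ≤-trans; ≤-reflexive)
open import Data.Fin.Base using (Fin; toℕ)
import Data.Fin.Properties as Fin
open import Data.Fin.Permutation using (_⟨$⟩ʳ_)
open import Data.Fin.Subset using () renaming (_∈_ to _∈ₛ_)
open import Data.List.Base using (List; []; _∷_; map; filter; reverse; tabulate)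
open import Data.List.Extrema.Nat using (argmin; argmin-sel; f[argmin]≤f[⊤]; f[argmin]≤f[xs])
open import Data.List.Membership.Propositional using (_∈_)
open import Data.List.Membership.Propositional.Properties
  using (∈-map⁺; ∈-map⁻; ∈-filter⁺; ∈-filter⁻; ∈-allFin; ∈-cartesianProduct⁺)
open import Data.List.Relation.Unary.All using (All; []; _∷_; all?)
import Data.List.Relation.Unary.All.Properties as All
open import Data.List.Relation.Binary.Permutation.Propositional using (↭-sym)
open import Data.List.Relation.Binary.Permutation.Propositional.Properties
  using (All-resp-↭; ↭-reverse)
open import Data.List.Relation.Unary.Any using (here; there)
open import Data.Maybe.Base using (Maybe; just; nothing)
open import Data.Product.Base using (_×_; _,_; proj₁; proj₂; ∃-syntax)
open import Data.Sum.Base using (_⊎_; inj₁; inj₂)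
open import Data.Unit.Base using (tt)
open import Data.Vec.Functional.Properties using (updateAt-updates; updateAt-minimal)
open import Function.Base using (_∘_)
open import Relation.Binary.Construct.Add.Supremum.NonStrict using ([_])
open import Relation.Binary.PropositionalEquality
  using (_≡_; _≢_; refl; sym; trans; cong; subst)
open import Relation.Nullary.Construct.Add.Supremum using (⊤⁺; [_])
open import Relation.Nullary.Decidable using (yes; no; ¬?)
open import Relation.Nullary.Negation.Core using (¬_; contradiction)

∉[] : ∀ {A : Set} {xs : List A} {x} → xs ≡ [] → ¬ x ∈ xs
∉[] refl ()

≥1⇒¬Exhausted-0 : ∀ {s} → [ 1 ] ≤⁺ s → ¬ Exhausted s 0
≥1⇒¬Exhausted-0 [ 1≤b ] [ b≤0 ] with () ← ≤-trans 1≤b b≤0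

¬Exhausted-∞ : ∀ {c} → ¬ Exhausted ⊤⁺ c
¬Exhausted-∞ ()

module _ {n m : ℕ} where

  private variable
    t    : Budget
    G G′ : Graph {n} {m}
    H    : History {n} {m}
    σ    : State {n} {m}
    j    : Fin m

  -- What a single decision of LCP guarantees.

  Matched : State {n} {m} → Fin n → Fin m → Set
  Matched σ x y = (x , y) ∈ matching σ

  Saturated : Graph {n} {m} → State {n} {m} → Fin m → Set
  Saturated G σ y = ∀ {i} → i ∈ₛ G y → ¬ Free σ i

  -- A path reads only the neighbourhoods of `j` and of a matched online vertex. This lets the graph
  -- revealed so far be exchanged for the full graph.
  Augmenting-resp : G j ≡ G′ j → (∀ {x y} → Matched σ x y → G y ≡ G′ y) →
                    ∀ p → Augmenting G σ j p → Augmenting G′ σ j p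
  Augmenting-resp eq eqs (path₁ i)     (i∈ , free) = subst (i ∈ₛ_) eq i∈ , free
  Augmenting-resp eq eqs (path₃ x y i) (x∈ , xy∈ , i∈ , free) =
    subst (x ∈ₛ_) eq x∈ , xy∈ , subst (i ∈ₛ_) (eqs xy∈) i∈ , free

  -- Abstracts a decision of LCP from costs and tie-breaking. `rerouted` records that the search for
  -- a direct match failed, and the offline budget is `⊤⁺` because LCP keeps no offline counters.
  data Outcome (t : Budget) (G : Graph {n} {m}) (σ : State {n} {m}) (j : Fin m) :
               Maybe (Path {n} {m}) → Set where
    direct   : ∀ {i} → i ∈ₛ G j → Free σ i → Outcome t G σ j (just (path₁ i))
    rerouted : ∀ {x y i} → Saturated G σ j → Feasible ⊤⁺ t G σ j (path₃ x y i) →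
               Outcome t G σ j (just (path₃ x y i))
    stuck    : (∀ p → ¬ Feasible ⊤⁺ t G σ j p) → Outcome t G σ j nothing

  Outcome-resp : G j ≡ G′ j → (∀ {x y} → Matched σ x y → G y ≡ G′ y) →
                 ∀ {d} → Outcome t G σ j d → Outcome t G′ σ j d
  Outcome-resp eq eqs (direct i∈ free) = direct (subst (_ ∈ₛ_) eq i∈) free
  Outcome-resp {j = j} {σ = σ} eq eqs (rerouted sat (aug , within)) =
    rerouted (sat ∘ subst (_ ∈ₛ_) (sym eq))
             (Augmenting-resp {j = j} {σ = σ} eq eqs (path₃ _ _ _) aug , within)
  Outcome-resp eq eqs (stuck none) =
    stuck λ p (aug , within) →
      none p (Augmenting-resp (sym eq) (sym ∘ eqs) p aug , within)

  path₁∈paths₁ : ∀ i → path₁ i ∈ paths₁ {n} {m}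
  path₁∈paths₁ i = ∈-map⁺ path₁ (∈-allFin i)

  path₃∈paths₃ : ∀ x y i → path₃ x y i ∈ paths₃ {n} {m}
  path₃∈paths₃ x y i =
    ∈-map⁺ _ (∈-cartesianProduct⁺ (∈-allFin x) (∈-cartesianProduct⁺ (∈-allFin y) (∈-allFin i)))

  cheapest-⊆ : ∀ (σ : State {n} {m}) ps {q} → q ∈ cheapest σ ps → q ∈ ps
  cheapest-⊆ σ ps q∈ = proj₁ (∈-filter⁻ (λ p → all? (λ q → cost σ p ≤? cost σ q) ps) q∈)

  -- A cost minimizer of a nonempty list survives the filter, so LCP gives up only when no feasible
  -- 3-path exists.
  cheapest-nonempty : ∀ (σ : State {n} {m}) ps → cheapest σ ps ≡ [] → ps ≡ []
  cheapest-nonempty σ []       _  = refl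
  cheapest-nonempty σ (p ∷ ps) eq =
    ⊥-elim (∉[] eq (∈-filter⁺ (λ p′ → all? (λ q → cost σ p′ ≤? cost σ q) (p ∷ ps)) best∈
      (f[argmin]≤f[⊤] {f = cost σ} p ps ∷ f[argmin]≤f[xs] {f = cost σ} p ps)))
    where
    best∈ : argmin (cost σ) p ps ∈ p ∷ ps
    best∈ with argmin-sel (cost σ) p ps
    ... | inj₁ ≡p  = here ≡p
    ... | inj₂ ∈ps = there ∈ps

  lcp-outcome : ∀ t τ H j N (σ : State {n} {m}) →
                Outcome t (revealed ((j , N) ∷ H)) σ j (lcp t τ H (j , N) σ)
  lcp-outcome t τ H j N σ
    with filter (augmenting? (revealed ((j , N) ∷ H)) σ j) paths₁ in eq₁
  ... | p ∷ ps = chosen (τ ((j , N) ∷ H) p ps)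
    where
    chosen : ((q , _) : ∃[ q ] q ∈ p ∷ ps) → Outcome t (revealed ((j , N) ∷ H)) σ j (just q)
    chosen (q , q∈) with ∈-filter⁻ (augmenting? (revealed ((j , N) ∷ H)) σ j)
                           {xs = paths₁} (subst (q ∈_) (sym eq₁) q∈)
    ... | q∈paths₁ , aug with ∈-map⁻ path₁ q∈paths₁
    ... | i , _ , refl = direct (proj₁ aug) (proj₂ aug)
  ... | [] with cheapest σ (filter (feasible? ⊤⁺ t (revealed ((j , N) ∷ H)) σ j) paths₃) in eq₃
  ...   | []     = stuck none
    where
    none : ∀ p → ¬ Feasible ⊤⁺ t (revealed ((j , N) ∷ H)) σ j p
    none (path₁ i) (aug , _) = ∉[] eq₁ (∈-filter⁺ (augmenting? _ σ j) (path₁∈paths₁ i) aug)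
    none (path₃ x y i) feas  =
      ∉[] (cheapest-nonempty σ _ eq₃) (∈-filter⁺ (feasible? ⊤⁺ t _ σ j) (path₃∈paths₃ x y i) feas)
  ...   | p ∷ ps = chosen (τ ((j , N) ∷ H) p ps)
    where
    chosen : ((q , _) : ∃[ q ] q ∈ p ∷ ps) → Outcome t (revealed ((j , N) ∷ H)) σ j (just q)
    chosen (q , q∈) with ∈-filter⁻ (feasible? ⊤⁺ t (revealed ((j , N) ∷ H)) σ j) {xs = paths₃}
                           (cheapest-⊆ σ (filter (feasible? ⊤⁺ t (revealed ((j , N) ∷ H)) σ j) paths₃)
                             (subst (q ∈_) (sym eq₃) q∈))
    ... | q∈paths₃ , feas
      with ∈-map⁻ {A = Fin n × Fin m × Fin n} (λ (x , y , i) → path₃ x y i) q∈paths₃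
    ... | _ , _ , refl = rerouted
      -- A free neighbour of `j` would give a length-1 path, but `eq₁` says that the list of these
      -- is empty.
      (λ i∈ free → ∉[] eq₁ (∈-filter⁺ (augmenting? _ σ j) (path₁∈paths₁ _) (i∈ , free))) feas

  -- Histories that agree with a fixed graph, and the invariant.

  Consistent : Graph {n} {m} → History {n} {m} → Set
  Consistent G = All λ (j , N) → N ≡ G j

  Consistent-reverse : Consistent G H → Consistent G (reverse H)
  Consistent-reverse = All-resp-↭ (↭-sym (↭-reverse _))

  revealed-consistent : ∀ {y} → Consistent G H → y ∈ map proj₁ H → revealed H y ≡ G y
  revealed-consistent {H = (j , N) ∷ H} {y} (N≡ ∷ con) y∈ with y Fin.≟ j | y∈
  ... | yes refl | _         = N≡
  ... | no y≢j   | here y≡j  = contradiction y≡j y≢j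
  ... | no _     | there y∈H = revealed-consistent con y∈H

  -- The core is `saturated-or-unmoved`. To preserve it, `free⇒unmoved` handles newly matched
  -- offline vertices, and `partner-unique` ensures that deleting `(x , y)` removes every old edge
  -- at `x`. `matched⇒arrived` ties the revealed neighbourhoods of matched vertices to `G`.
  record Invariant (G : Graph {n} {m}) (H : History {n} {m}) (σ : State {n} {m}) : Set where
    field
      reassigned≤1         : ∀ x → reassignedL σ x ≤ 1
      free⇒unmoved         : ∀ {x} → Free σ x → reassignedL σ x ≡ 0
      partner-unique       : ∀ {x y y′} → Matched σ x y → Matched σ x y′ → y ≡ y′
      saturated-or-unmoved : ∀ {x y} → Matched σ x y → Saturated G σ y ⊎ reassignedL σ x ≡ 0
      matched⇒arrived      : ∀ {x y} → Matched σ x y → y ∈ map proj₁ H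

    -- The free end `i` is a neighbour of `y`, so `y` is not saturated and only the other
    -- alternative is left.
    path₃⇒unmoved : ∀ {x y i} → Augmenting G σ j (path₃ x y i) → reassignedL σ x ≡ 0
    path₃⇒unmoved (_ , xy∈ , i∈ , free) with saturated-or-unmoved xy∈
    ... | inj₁ sat = contradiction free (sat i∈)
    ... | inj₂ ≡0  = ≡0

  open Invariant

  -- Preservation of the invariant by each kind of step.

  Invariant-initial : Invariant G [] initial
  Invariant-initial = record
    { reassigned≤1         = λ _ → z≤n
    ; free⇒unmoved         = λ _ → refl
    ; partner-unique       = λ ()
    ; saturated-or-unmoved = λ ()
    ; matched⇒arrived      = λ ()
    }

  Invariant-idle : ∀ {a} → Invariant G H σ → Invariant G (a ∷ H) σ
  Invariant-idle inv = record
    { reassigned≤1         = reassigned≤1 inv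
    ; free⇒unmoved         = free⇒unmoved inv
    ; partner-unique       = partner-unique inv
    ; saturated-or-unmoved = saturated-or-unmoved inv
    ; matched⇒arrived      = there ∘ matched⇒arrived inv
    }

  Invariant-path₁ : ∀ {N i} → Free σ i → Invariant G H σ →
                    Invariant G ((j , N) ∷ H) (augment j (path₁ i) σ)
  Invariant-path₁ {σ = σ} {G = G} {j = j} {i = i} free inv = record
    { reassigned≤1         = reassigned≤1 inv
    ; free⇒unmoved         = free⇒unmoved inv ∘ still-free
    ; partner-unique       = unique
    ; saturated-or-unmoved = sat
    ; matched⇒arrived      = λ where
        (here refl) → here refl
        (there xy∈) → there (matched⇒arrived inv xy∈)
    }
    where
    σ′ : State {n} {m}
    σ′ = augment j (path₁ i) σ

    still-free : ∀ {z} → Free σ′ z → Free σ z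
    still-free free′ (y , zy∈) = free′ (y , there zy∈)

    unique : ∀ {x y y′} → Matched σ′ x y → Matched σ′ x y′ → y ≡ y′
    unique (here refl) (here refl) = refl
    unique (here refl) (there xy∈) = ⊥-elim (free (_ , xy∈))
    unique (there xy∈) (here refl) = ⊥-elim (free (_ , xy∈))
    unique (there xy∈) (there xy′∈) = partner-unique inv xy∈ xy′∈

    sat : ∀ {x y} → Matched σ′ x y → Saturated G σ′ y ⊎ reassignedL σ′ x ≡ 0
    sat (here refl) = inj₂ (free⇒unmoved inv free)
    sat (there xy∈) with saturated-or-unmoved inv xy∈
    ... | inj₁ s  = inj₁ λ i∈ → s i∈ ∘ still-free
    ... | inj₂ ≡0 = inj₂ ≡0

  Invariant-path₃ : ∀ {N x y i} → Saturated G σ j → Augmenting G σ j (path₃ x y i) →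
                    Invariant G H σ → Invariant G ((j , N) ∷ H) (augment j (path₃ x y i) σ)
  Invariant-path₃ {G = G} {σ = σ} {j = j} {H = H} {N = N} {x = x} {y} {i}
                  saturated aug@(_ , xy∈ , _ , free) inv = record
    { reassigned≤1         = ≤1
    ; free⇒unmoved         = λ free′ →
        trans (unchanged λ { refl → free′ (j , here refl) }) (free⇒unmoved inv (still-free free′))
    ; partner-unique       = λ p q → unique (edges p) (edges q)
    ; saturated-or-unmoved = sat ∘ edges
    ; matched⇒arrived      = arrived ∘ edges
    }
    where
    σ′ : State {n} {m}
    σ′ = augment j (path₃ x y i) σ

    x≢i : x ≢ i
    x≢i refl = free (y , xy∈)

    unchanged : ∀ {z} → z ≢ x → reassignedL σ′ z ≡ reassignedL σ z
    unchanged {z} z≢x = updateAt-minimal z x (reassignedL σ) z≢x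

    ≤1 : ∀ z → reassignedL σ′ z ≤ 1
    ≤1 z with z Fin.≟ x
    -- The counter of `x` was 0 before this path, so it is now exactly 1.
    ... | yes refl = ≤-reflexive
      (trans (updateAt-updates x (reassignedL σ)) (cong suc (path₃⇒unmoved inv {j = j} aug)))
    ... | no z≢x   = subst (_≤ 1) (sym (unchanged z≢x)) (reassigned≤1 inv z)

    -- Classifies the edges of the new matching by their offline end: `x`, `i`, or neither. The
    -- three cases are disjoint because `x` and `i` differ.
    data Edges : Fin n → Fin m → Set where
      new  : Edges x j
      new′ : Edges i y
      old  : ∀ {a b} → a ≢ x → a ≢ i → Matched σ a b → Edges a b

    edges : ∀ {a b} → Matched σ′ a b → Edges a b
    edges (here refl)          = new
    edges (there (here refl))  = new′
    edges (there (there ab∈′)) with ∈-filter⁻ (λ e → ¬? (e ≟ᴱ (x , y))) {xs = matching σ} ab∈′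
    ... | ab∈ , ab≢xy = old
      -- An old edge at `x` could only be `(x , y)`, which the filter removed.
      (λ { refl → ab≢xy (cong (x ,_) (partner-unique inv ab∈ xy∈)) })
      (λ { refl → free (_ , ab∈) })
      ab∈

    -- Matched offline vertices stay matched: the only deleted edge is `(x , y)`, and `x` is
    -- rematched to `j`. Hence saturation persists.
    still-free : ∀ {z} → Free σ′ z → Free σ z
    still-free {z} free′ (b , zb∈) with (z , b) ≟ᴱ (x , y)
    ... | yes refl  = free′ (j , here refl)
    ... | no zb≢xy =
      free′ (b , there (there (∈-filter⁺ (λ e → ¬? (e ≟ᴱ (x , y))) zb∈ zb≢xy)))

    unique : ∀ {a b b′} → Edges a b → Edges a b′ → b ≡ b′
    unique new           new           = refl
    unique new           new′          = contradiction refl x≢i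
    unique new           (old a≢x _ _) = contradiction refl a≢x
    unique new′          new           = contradiction refl x≢i
    unique new′          new′          = refl
    unique new′          (old _ a≢i _) = contradiction refl a≢i
    unique (old a≢x _ _) new           = contradiction refl a≢x
    unique (old _ a≢i _) new′          = contradiction refl a≢i
    unique (old _ _ p)   (old _ _ q)   = partner-unique inv p q

    sat : ∀ {a b} → Edges a b → Saturated G σ′ b ⊎ reassignedL σ′ a ≡ 0
    -- The reassigned `x` gets a saturated partner, since `j` had no free neighbour on arrival.
    sat new  = inj₁ λ i∈ → saturated i∈ ∘ still-free
    -- Here `y` may still have free neighbours, but `i` was free and so had never been reassigned.
    sat new′ = inj₂ (trans (unchanged (x≢i ∘ sym)) (free⇒unmoved inv free))
    sat (old a≢x _ ab∈) with saturated-or-unmoved inv ab∈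
    ... | inj₁ s  = inj₁ λ i∈ → s i∈ ∘ still-free
    ... | inj₂ ≡0 = inj₂ (trans (unchanged a≢x) ≡0)

    arrived : ∀ {a b} → Edges a b → b ∈ map proj₁ ((j , N) ∷ H)
    arrived new           = here refl
    arrived new′          = there (matched⇒arrived inv xy∈)
    arrived (old _ _ ab∈) = there (matched⇒arrived inv ab∈)

  -- The invariant along runs of LCP, and greediness.

  module _ {t : Budget} {τ : TieBreak {n} {m}} where

    lcp-outcome-consistent : Consistent G H → Invariant G H σ →
                             ∀ j → Outcome t G σ j (lcp t τ H (j , G j) σ)
    lcp-outcome-consistent {G = G} {H = H} {σ = σ} con inv j = Outcome-resp
      (revealed-consistent (refl ∷ con) (here refl))
      (revealed-consistent (refl ∷ con) ∘ there ∘ matched⇒arrived inv)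
      (lcp-outcome t τ H j (G j) σ)

    lcp-invariant : Consistent G H → Invariant G H (execute (lcp t τ) H)
    lcp-invariant []                            = Invariant-initial
    lcp-invariant {G = G} {H = (j , _) ∷ H} (refl ∷ con) =
      preserved (lcp-outcome-consistent con ih j)
      where
      ih : Invariant G H (execute (lcp t τ) H)
      ih = lcp-invariant con

      preserved : ∀ {d} → Outcome t G (execute (lcp t τ) H) j d →
                  Invariant G ((j , G j) ∷ H) (step j d (execute (lcp t τ) H))
      preserved (direct _ free)          = Invariant-path₁ free ih
      preserved (rerouted sat (aug , _)) = Invariant-path₃ sat aug ih
      preserved (stuck _)                = Invariant-idle ih

  GreedyDecision : (s t : Budget) → Graph {n} {m} → State {n} {m} → Fin m →
                   Maybe (Path {n} {m}) → Set
  GreedyDecision s t G σ j d =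
    ((∃[ p ] Feasible s t G σ j p) → ∃[ p ] d ≡ just p × Feasible s t G σ j p)
    × (¬ (∃[ p ] Feasible s t G σ j p) → d ≡ nothing)

  -- By the invariant, every 3-path starts its rerouting at an offline vertex with counter 0, so the
  -- budget `s` never blocks LCP's choice. Conversely, feasibility for `s` implies feasibility for
  -- `⊤⁺`, so when LCP is stuck nothing was available.
  outcome⇒greedy : ∀ {s d} → [ 1 ] ≤⁺ s → Invariant G H σ → Outcome t G σ j d →
                   GreedyDecision s t G σ j d
  outcome⇒greedy {G = G} {σ = σ} {t = t} {j = j} {s = s} 1≤s inv = greedy
    where
    available : ∀ {p} → Feasible s t G σ j p → GreedyDecision s t G σ j (just p)
    available {p} feas = (λ _ → p , refl , feas) , λ none → ⊥-elim (none (p , feas))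

    unbounded : ∀ p → Feasible s t G σ j p → Feasible ⊤⁺ t G σ j p
    unbounded (path₁ i)     feas               = feas
    unbounded (path₃ x y i) (aug , _ , within) = aug , ¬Exhausted-∞ , within

    greedy : ∀ {d} → Outcome t G σ j d → GreedyDecision s t G σ j d
    greedy (direct i∈ free)                = available ((i∈ , free) , tt)
    greedy (rerouted _ (aug , _ , within)) = available
      (aug , subst (λ c → ¬ Exhausted s c) (sym (path₃⇒unmoved inv {j = j} aug)) (≥1⇒¬Exhausted-0 1≤s)
           , within)
    greedy (stuck none)                    =
      (λ (p , feas) → ⊥-elim (none p (unbounded p feas))) , λ _ → refl

  arrivals-consistent : ∀ (I : Instance n m) → Consistent (graph I) (tabulate (arrival I))
  arrivals-consistent I = All.tabulate⁺ λ _ → refl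

lemma12 : ∀ {n m : ℕ} (s t : Budget) → [ 1 ] ≤⁺ s → (τ : TieBreak {n} {m}) →
    (∀ (I : Instance n m) (x : Fin n) →
    reassignedL (execute (lcp t τ) (complete I)) x ≤ 1)
    × SPGreedy s t (lcp t τ)
lemma12 s t 1≤s τ =
  (λ I → Invariant.reassigned≤1 (lcp-invariant (Consistent-reverse (arrivals-consistent I)))) ,
  -- The history before the `k`-th arrival is a reversed prefix of the arrival list, and consistency
  -- passes to prefixes and reversals.
  λ I k → let con = Consistent-reverse (All.take⁺ (toℕ k) (arrivals-consistent I))
              inv = lcp-invariant con
          in outcome⇒greedy 1≤s inv (lcp-outcome-consistent con inv (order I ⟨$⟩ʳ k))
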